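{- Let $K$ be a Kleene algebra, $n$ a positive integer, and $M$ the Kleene algebra of $n\times n$ matrices over $K$. Then $K$ is Morita-equivalent with $M$ (as Kleene algebras): there exist a Kleene $(K,M)$-bimodule $X$ and a Kleene $(M,K)$-bimodule $Y$ with $X\otimes_M Y\cong {}_KK_K$ and $Y\otimes_K X\cong {}_MM_M$ as bimodules.
   Context: A semiring $\langle S,+,\cdot,0,1\rangle$ is unital: $\langle S,+,0\rangle$ is a commutative monoid, $\langle S,\cdot,1\rangle$ is a monoid, $s0=0s=0$ for all $s$, and multiplication distributes over addition on both sides. A left module over a semiring $S$ is a commutative monoid $\langle M,+,0\rangle$ with a map $S\times M\to M$ satisfying $s(m+n)=sm+sn$, $(s+t)m=sm+tm$, $s(tm)=(st)m$, $1m=m$, $0m=0$; right modules are defined symmetrically. An $(S,T)$-bimodule is a left $S$-module and right $T$-module on the same commutative monoid with $s(mt)=(sm)t$. Homomorphisms are maps preserving addition and the scalar action(s); isomorphisms are invertible homomorphisms. A Kleene algebra is an additively idempotent semiring $K$ ($x+x=x$), ordered by $x\le y\iff x+y=y$, with a unary operation $*$ such that for all $x,y,z$: $1+xx^*=1+x^*x=x^*$; if $x+yz\le z$ then $y^*x\le z$; if $x+zy\le z$ then $xy^*\le z$. A left Kleene module over $K$ is a left module $M$ over the semiring reduct of $K$ such that $am\le m\Rightarrow a^*m\le m$ for all $a\in K$, $m\in M$ (where $x\le y\iff x+y=y$); a right Kleene module is defined symmetrically ($ma\le m\Rightarrow ma^*\le m$). A Kleene $(K,L)$-bimodule is a semiring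 $(K,L)$-bimodule that is both a left Kleene module over $K$ and a right Kleene module over $L$. The $n\times n$ matrices over $K$, with the usual matrix addition and multiplication, form a Kleene algebra under the standard matrix asterate, defined recursively via block decomposition (with $a,d$ square) by $$\begin{pmatrix} a&b\\c&d\end{pmatrix}^*=\begin{pmatrix} f& fbd^*\\ d^*cf& d^*+d^*cfbd^*\end{pmatrix},\qquad f=(a+bd^*c)^*.$$ (The operation $*$ of a Kleene algebra is uniquely determined by its semiring reduct.) Tensor product: for an $(A,B)$-bimodule $X$ and a $(B,C)$-bimodule $Y$, $X\otimes_B Y$ is the quotient of the commutative monoid of finite formal sums of pairs $(x,y)\in X\times Y$ by the least congruence under which the class $x\otimes y$ of $(x,y)$ is additive in each variable (with $0\otimes y=x\otimes 0=0$) and $B$-balanced, $xb\otimes y=x\otimes by$; it is an $(A,C)$-bimodule via $a(x\otimes y)=(ax)\otimes y$ and $(x\otimes y)c=x\otimes(yc)$. ${}_KK_K$ denotes $K$ as a bimodule over itself by multiplication. -}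

module Defs where

open import Level using (Level; _⊔_) renaming (suc to lsuc)
open import Algebra.Bundles using (IdempotentSemiring; Semiring; CommutativeMonoid)
open import Algebra.Core using (Op₁; Op₂)
open import Algebra.Structures using (IsCommutativeMonoid)
open import Algebra.Module.Bundles
  using (LeftSemimodule; RightSemimodule; Bisemimodule)
open import Algebra.Module.Construct.TensorUnit using (bisemimodule)
open import Algebra.Module.Morphism.Structures using (module BisemimoduleMorphisms)
import Algebra.Properties.CommutativeSemigroup
import Algebra.Properties.Semiring.Sum
open import Data.Fin.Base using (Fin; zero; suc)
open import Data.List.Base using (List; []; _∷_; [_]; _++_; map)
open import Data.List.Properties using (++-assoc; ++-identityʳ; map-++)
open import Data.Nat.Base using (ℕ; zero; suc)
open import Data.Product.Base using (_×_; _,_; map₁; map₂)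
open import Data.Vec.Functional using (Vector)
open import Function.Definitions using (Inverseᵇ)
open import Relation.Binary.Bundles using (Poset)
open import Relation.Binary.Core using (Rel)
import Relation.Binary.PropositionalEquality.Core as ≡
import Relation.Binary.Reasoning.PartialOrder
import Relation.Binary.Reasoning.Setoid

-- Not Algebra.Bundles.KleeneAlgebra: its axiom
--   StarLeftDestructive : ∀ a b x → b + a * x ≈ x → a ⋆ * b ≈ x
-- concludes with an equation rather than an inequality, and at a = 1#, b = 0#
-- it forces every x to be ≈ 0#.

record KleeneAlgebra c ℓ : Set (lsuc (c ⊔ ℓ)) where
  infix 8 _⋆
  infix 4 _≤_

  field
    idempotentSemiring : IdempotentSemiring c ℓ

  open IdempotentSemiring idempotentSemiring public

  _≤_ : Rel Carrier ℓ
  x ≤ y = x + y ≈ y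

  field
    _⋆        : Op₁ Carrier
    ⋆-unfoldˡ : ∀ x → 1# + x * x ⋆ ≈ x ⋆
    ⋆-unfoldʳ : ∀ x → 1# + x ⋆ * x ≈ x ⋆
    ⋆-inductˡ : ∀ x y z → x + y * z ≤ z → y ⋆ * x ≤ z
    ⋆-inductʳ : ∀ x y z → x + z * y ≤ z → x * y ⋆ ≤ z

module _ {c ℓ m ℓm : Level} (K : KleeneAlgebra c ℓ) where
  open KleeneAlgebra K using (Carrier; _⋆; semiring)

  IsLeftKleeneModule : LeftSemimodule semiring m ℓm → Set (c ⊔ m ⊔ ℓm)
  IsLeftKleeneModule M = ∀ (a : Carrier) (x : Carrierᴹ) →
                         a *ₗ x ≤ᴹ x → a ⋆ *ₗ x ≤ᴹ x
    where
    open LeftSemimodule M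
    infix 4 _≤ᴹ_
    _≤ᴹ_ : Rel Carrierᴹ ℓm
    x ≤ᴹ y = x +ᴹ y ≈ᴹ y

  IsRightKleeneModule : RightSemimodule semiring m ℓm → Set (c ⊔ m ⊔ ℓm)
  IsRightKleeneModule M = ∀ (a : Carrier) (x : Carrierᴹ) →
                          x *ᵣ a ≤ᴹ x → x *ᵣ a ⋆ ≤ᴹ x
    where
    open RightSemimodule M
    infix 4 _≤ᴹ_
    _≤ᴹ_ : Rel Carrierᴹ ℓm
    x ≤ᴹ y = x +ᴹ y ≈ᴹ y

record KleeneBimodule {c₁ ℓ₁ c₂ ℓ₂ : Level}
                      (K : KleeneAlgebra c₁ ℓ₁) (L : KleeneAlgebra c₂ ℓ₂)
                      (m ℓm : Level)
                      : Set (c₁ ⊔ ℓ₁ ⊔ c₂ ⊔ ℓ₂ ⊔ lsuc (m ⊔ ℓm)) where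
  private
    module K = KleeneAlgebra K
    module L = KleeneAlgebra L

  field
    bimodule : Bisemimodule K.semiring L.semiring m ℓm

  open Bisemimodule bimodule public

  field
    isLeftKleeneModule  : IsLeftKleeneModule K leftSemimodule
    isRightKleeneModule : IsRightKleeneModule L rightSemimodule

record BimoduleIso {r ℓr s ℓs m₁ ℓm₁ m₂ ℓm₂ : Level}
                   {R : Semiring r ℓr} {S : Semiring s ℓs}
                   (M₁ : Bisemimodule R S m₁ ℓm₁) (M₂ : Bisemimodule R S m₂ ℓm₂)
                   : Set (r ⊔ s ⊔ m₁ ⊔ ℓm₁ ⊔ m₂ ⊔ ℓm₂) where
  private
    module M₁ = Bisemimodule M₁
    module M₂ = Bisemimodule M₂
    module To = BisemimoduleMorphisms M₁.rawBisemimodule M₂.rawBisemimodule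
    module From = BisemimoduleMorphisms M₂.rawBisemimodule M₁.rawBisemimodule

  field
    to        : M₁.Carrierᴹ → M₂.Carrierᴹ
    from      : M₂.Carrierᴹ → M₁.Carrierᴹ
    to-homo   : To.IsBisemimoduleHomomorphism to
    from-homo : From.IsBisemimoduleHomomorphism from
    inverse   : Inverseᵇ M₁._≈ᴹ_ M₂._≈ᴹ_ to from

module Tensor {a ℓa b ℓb c ℓc x ℓx y ℓy : Level}
              {A : Semiring a ℓa} {B : Semiring b ℓb} {C : Semiring c ℓc}
              (X : Bisemimodule A B x ℓx) (Y : Bisemimodule B C y ℓy) where
  private
    module A = Semiring A
    module B = Semiring B
    module C = Semiring C
    module X = Bisemimodule X
    module Y = Bisemimodule Y

  -- A formal sum is a list of its terms; ⊗-comm makes the order irrelevant.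

  FormalSum : Set (x ⊔ y)
  FormalSum = List (X.Carrierᴹ × Y.Carrierᴹ)

  infix 4 _≈⊗_

  data _≈⊗_ : Rel FormalSum (b ⊔ x ⊔ ℓx ⊔ y ⊔ ℓy) where
    ⊗-refl     : ∀ {s} → s ≈⊗ s
    ⊗-sym      : ∀ {s t} → s ≈⊗ t → t ≈⊗ s
    ⊗-trans    : ∀ {s t u} → s ≈⊗ t → t ≈⊗ u → s ≈⊗ u
    ⊗-++-cong  : ∀ {s s′ t t′} → s ≈⊗ s′ → t ≈⊗ t′ → s ++ t ≈⊗ s′ ++ t′
    ⊗-comm     : ∀ s t → s ++ t ≈⊗ t ++ s
    ⊗-cong     : ∀ {x x′ y y′} → x X.≈ᴹ x′ → y Y.≈ᴹ y′ → [ (x , y) ] ≈⊗ [ (x′ , y′) ]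
    ⊗-distribʳ : ∀ x x′ y → [ (x X.+ᴹ x′ , y) ] ≈⊗ (x , y) ∷ (x′ , y) ∷ []
    ⊗-distribˡ : ∀ x y y′ → [ (x , y Y.+ᴹ y′) ] ≈⊗ (x , y) ∷ (x , y′) ∷ []
    ⊗-zeroˡ    : ∀ y → [ (X.0ᴹ , y) ] ≈⊗ []
    ⊗-zeroʳ    : ∀ x → [ (x , Y.0ᴹ) ] ≈⊗ []
    ⊗-balanced : ∀ x b y → [ (x X.*ᵣ b , y) ] ≈⊗ [ (x , b Y.*ₗ y) ]

  infixr 7 _*ₗ_
  infixl 7 _*ᵣ_

  _*ₗ_ : A.Carrier → FormalSum → FormalSum
  a *ₗ s = map (map₁ (a X.*ₗ_)) s

  _*ᵣ_ : FormalSum → C.Carrier → FormalSum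
  s *ᵣ c = map (map₂ (Y._*ᵣ c)) s

  private
    ⊗-reflexive : ∀ {s t} → s ≡.≡ t → s ≈⊗ t
    ⊗-reflexive ≡.refl = ⊗-refl

    ∷-cong : ∀ {x x′ y y′ s s′} → x X.≈ᴹ x′ → y Y.≈ᴹ y′ → s ≈⊗ s′ →
             (x , y) ∷ s ≈⊗ (x′ , y′) ∷ s′
    ∷-cong p q r = ⊗-++-cong (⊗-cong p q) r

  ++-isCommutativeMonoid : IsCommutativeMonoid _≈⊗_ _++_ []
  ++-isCommutativeMonoid = record
    { isMonoid = record
      { isSemigroup = record
        { isMagma = record
          { isEquivalence = record { refl = ⊗-refl ; sym = ⊗-sym ; trans = ⊗-trans }
          ; ∙-cong        = ⊗-++-cong
          }
        ; assoc = λ s t u → ⊗-reflexive (++-assoc s t u)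
        }
      ; identity = (λ s → ⊗-refl) , (λ s → ⊗-reflexive (++-identityʳ s))
      }
    ; comm = ⊗-comm
    }

  private
    ++-commutativeMonoid : CommutativeMonoid _ _
    ++-commutativeMonoid = record { isCommutativeMonoid = ++-isCommutativeMonoid }

    open CommutativeMonoid ++-commutativeMonoid using (commutativeSemigroup)
    open Algebra.Properties.CommutativeSemigroup commutativeSemigroup
      using (interchange)

    *ₗ-++ : ∀ a s t → a *ₗ (s ++ t) ≡.≡ a *ₗ s ++ a *ₗ t
    *ₗ-++ a = map-++ (map₁ (a X.*ₗ_))

    *ᵣ-++ : ∀ c s t → (s ++ t) *ᵣ c ≡.≡ s *ᵣ c ++ t *ᵣ c
    *ᵣ-++ c = map-++ (map₂ (Y._*ᵣ c))

    ++-resp : ∀ {s s′ t t′ : FormalSum} → s ≡.≡ t → s′ ≡.≡ t′ → t ≈⊗ t′ → s ≈⊗ s′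
    ++-resp ≡.refl ≡.refl p = p

    *ₗ-congˡ : ∀ a {s t} → s ≈⊗ t → a *ₗ s ≈⊗ a *ₗ t
    *ₗ-congˡ a ⊗-refl = ⊗-refl
    *ₗ-congˡ a (⊗-sym p) = ⊗-sym (*ₗ-congˡ a p)
    *ₗ-congˡ a (⊗-trans p q) = ⊗-trans (*ₗ-congˡ a p) (*ₗ-congˡ a q)
    *ₗ-congˡ a (⊗-++-cong {s} {s′} {t} {t′} p q) =
      ++-resp (*ₗ-++ a s t) (*ₗ-++ a s′ t′) (⊗-++-cong (*ₗ-congˡ a p) (*ₗ-congˡ a q))
    *ₗ-congˡ a (⊗-comm s t) = ++-resp (*ₗ-++ a s t) (*ₗ-++ a t s) (⊗-comm (a *ₗ s) (a *ₗ t))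
    *ₗ-congˡ a (⊗-cong p q) = ⊗-cong (X.*ₗ-congˡ p) q
    *ₗ-congˡ a (⊗-distribʳ x x′ y) =
      ⊗-trans (⊗-cong (X.*ₗ-distribˡ a x x′) Y.≈ᴹ-refl) (⊗-distribʳ _ _ y)
    *ₗ-congˡ a (⊗-distribˡ x y y′) = ⊗-distribˡ _ y y′
    *ₗ-congˡ a (⊗-zeroˡ y) = ⊗-trans (⊗-cong (X.*ₗ-zeroʳ a) Y.≈ᴹ-refl) (⊗-zeroˡ y)
    *ₗ-congˡ a (⊗-zeroʳ x) = ⊗-zeroʳ _
    *ₗ-congˡ a (⊗-balanced x b y) =
      ⊗-trans (⊗-cong (X.≈ᴹ-sym (X.*ₗ-*ᵣ-assoc a x b)) Y.≈ᴹ-refl) (⊗-balanced _ b y)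

    *ₗ-congʳ : ∀ {a a′} → a A.≈ a′ → ∀ s → a *ₗ s ≈⊗ a′ *ₗ s
    *ₗ-congʳ p []            = ⊗-refl
    *ₗ-congʳ p ((x , y) ∷ s) = ∷-cong (X.*ₗ-congʳ p) Y.≈ᴹ-refl (*ₗ-congʳ p s)

    *ₗ-zeroˡ : ∀ s → A.0# *ₗ s ≈⊗ []
    *ₗ-zeroˡ []            = ⊗-refl
    *ₗ-zeroˡ ((x , y) ∷ s) =
      ⊗-++-cong (⊗-trans (⊗-cong (X.*ₗ-zeroˡ x) Y.≈ᴹ-refl) (⊗-zeroˡ y)) (*ₗ-zeroˡ s)

    *ₗ-distribʳ : ∀ s a a′ → (a A.+ a′) *ₗ s ≈⊗ a *ₗ s ++ a′ *ₗ s
    *ₗ-distribʳ []            a a′ = ⊗-refl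
    *ₗ-distribʳ ((x , y) ∷ s) a a′ = ⊗-trans
      (⊗-++-cong
        (⊗-trans (⊗-cong (X.*ₗ-distribʳ x a a′) Y.≈ᴹ-refl) (⊗-distribʳ _ _ y))
        (*ₗ-distribʳ s a a′))
      (interchange [ (a X.*ₗ x , y) ] [ (a′ X.*ₗ x , y) ] (a *ₗ s) (a′ *ₗ s))

    *ₗ-identityˡ : ∀ s → A.1# *ₗ s ≈⊗ s
    *ₗ-identityˡ []            = ⊗-refl
    *ₗ-identityˡ ((x , y) ∷ s) = ∷-cong (X.*ₗ-identityˡ x) Y.≈ᴹ-refl (*ₗ-identityˡ s)

    *ₗ-assoc : ∀ a a′ s → (a A.* a′) *ₗ s ≈⊗ a *ₗ (a′ *ₗ s)
    *ₗ-assoc a a′ []            = ⊗-refl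
    *ₗ-assoc a a′ ((x , y) ∷ s) = ∷-cong (X.*ₗ-assoc a a′ x) Y.≈ᴹ-refl (*ₗ-assoc a a′ s)

    *ᵣ-congʳ : ∀ c {s t} → s ≈⊗ t → s *ᵣ c ≈⊗ t *ᵣ c
    *ᵣ-congʳ c ⊗-refl = ⊗-refl
    *ᵣ-congʳ c (⊗-sym p) = ⊗-sym (*ᵣ-congʳ c p)
    *ᵣ-congʳ c (⊗-trans p q) = ⊗-trans (*ᵣ-congʳ c p) (*ᵣ-congʳ c q)
    *ᵣ-congʳ c (⊗-++-cong {s} {s′} {t} {t′} p q) =
      ++-resp (*ᵣ-++ c s t) (*ᵣ-++ c s′ t′) (⊗-++-cong (*ᵣ-congʳ c p) (*ᵣ-congʳ c q))
    *ᵣ-congʳ c (⊗-comm s t) = ++-resp (*ᵣ-++ c s t) (*ᵣ-++ c t s) (⊗-comm (s *ᵣ c) (t *ᵣ c))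
    *ᵣ-congʳ c (⊗-cong p q) = ⊗-cong p (Y.*ᵣ-congʳ q)
    *ᵣ-congʳ c (⊗-distribʳ x x′ y) = ⊗-distribʳ x x′ _
    *ᵣ-congʳ c (⊗-distribˡ x y y′) =
      ⊗-trans (⊗-cong X.≈ᴹ-refl (Y.*ᵣ-distribʳ c y y′)) (⊗-distribˡ x _ _)
    *ᵣ-congʳ c (⊗-zeroˡ y) = ⊗-zeroˡ _
    *ᵣ-congʳ c (⊗-zeroʳ x) = ⊗-trans (⊗-cong X.≈ᴹ-refl (Y.*ᵣ-zeroˡ c)) (⊗-zeroʳ x)
    *ᵣ-congʳ c (⊗-balanced x b y) =
      ⊗-trans (⊗-balanced x b _) (⊗-cong X.≈ᴹ-refl (Y.≈ᴹ-sym (Y.*ₗ-*ᵣ-assoc b y c)))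

    *ᵣ-congˡ : ∀ {c c′} → c C.≈ c′ → ∀ s → s *ᵣ c ≈⊗ s *ᵣ c′
    *ᵣ-congˡ p []            = ⊗-refl
    *ᵣ-congˡ p ((x , y) ∷ s) = ∷-cong X.≈ᴹ-refl (Y.*ᵣ-congˡ p) (*ᵣ-congˡ p s)

    *ᵣ-zeroʳ : ∀ s → s *ᵣ C.0# ≈⊗ []
    *ᵣ-zeroʳ []            = ⊗-refl
    *ᵣ-zeroʳ ((x , y) ∷ s) =
      ⊗-++-cong (⊗-trans (⊗-cong X.≈ᴹ-refl (Y.*ᵣ-zeroʳ y)) (⊗-zeroʳ x)) (*ᵣ-zeroʳ s)

    *ᵣ-distribˡ : ∀ s c c′ → s *ᵣ (c C.+ c′) ≈⊗ s *ᵣ c ++ s *ᵣ c′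
    *ᵣ-distribˡ []            c c′ = ⊗-refl
    *ᵣ-distribˡ ((x , y) ∷ s) c c′ = ⊗-trans
      (⊗-++-cong
        (⊗-trans (⊗-cong X.≈ᴹ-refl (Y.*ᵣ-distribˡ y c c′)) (⊗-distribˡ x _ _))
        (*ᵣ-distribˡ s c c′))
      (interchange [ (x , y Y.*ᵣ c) ] [ (x , y Y.*ᵣ c′) ] (s *ᵣ c) (s *ᵣ c′))

    *ᵣ-identityʳ : ∀ s → s *ᵣ C.1# ≈⊗ s
    *ᵣ-identityʳ []            = ⊗-refl
    *ᵣ-identityʳ ((x , y) ∷ s) = ∷-cong X.≈ᴹ-refl (Y.*ᵣ-identityʳ y) (*ᵣ-identityʳ s)

    *ᵣ-assoc : ∀ s c c′ → (s *ᵣ c) *ᵣ c′ ≈⊗ s *ᵣ (c C.* c′)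
    *ᵣ-assoc []            c c′ = ⊗-refl
    *ᵣ-assoc ((x , y) ∷ s) c c′ = ∷-cong X.≈ᴹ-refl (Y.*ᵣ-assoc y c c′) (*ᵣ-assoc s c c′)

    *ₗ-*ᵣ-assoc : ∀ a s c → (a *ₗ s) *ᵣ c ≈⊗ a *ₗ (s *ᵣ c)
    *ₗ-*ᵣ-assoc a []            c = ⊗-refl
    *ₗ-*ᵣ-assoc a ((x , y) ∷ s) c = ∷-cong X.≈ᴹ-refl Y.≈ᴹ-refl (*ₗ-*ᵣ-assoc a s c)

  tensorProduct : Bisemimodule A C (x ⊔ y) (b ⊔ x ⊔ ℓx ⊔ y ⊔ ℓy)
  tensorProduct = record
    { Carrierᴹ = FormalSum
    ; _≈ᴹ_     = _≈⊗_
    ; _+ᴹ_     = _++_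
    ; _*ₗ_     = _*ₗ_
    ; _*ᵣ_     = _*ᵣ_
    ; 0ᴹ       = []
    ; isBisemimodule = record
      { +ᴹ-isCommutativeMonoid = ++-isCommutativeMonoid
      ; isPreleftSemimodule = record
        { *ₗ-cong      = λ {a} {a′} {s} {t} p q → ⊗-trans (*ₗ-congˡ a q) (*ₗ-congʳ p t)
        ; *ₗ-zeroˡ     = *ₗ-zeroˡ
        ; *ₗ-distribʳ  = *ₗ-distribʳ
        ; *ₗ-identityˡ = *ₗ-identityˡ
        ; *ₗ-assoc     = *ₗ-assoc
        ; *ₗ-zeroʳ     = λ a → ⊗-refl
        ; *ₗ-distribˡ  = λ a s t → ⊗-reflexive (*ₗ-++ a s t)
        }
      ; isPrerightSemimodule = record
        { *ᵣ-cong      = λ {s} {t} {c} {c′} p q → ⊗-trans (*ᵣ-congʳ c p) (*ᵣ-congˡ q t)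
        ; *ᵣ-zeroʳ     = *ᵣ-zeroʳ
        ; *ᵣ-distribˡ  = *ᵣ-distribˡ
        ; *ᵣ-identityʳ = *ᵣ-identityʳ
        ; *ᵣ-assoc     = *ᵣ-assoc
        ; *ᵣ-zeroˡ     = λ c → ⊗-refl
        ; *ᵣ-distribʳ  = λ c s t → ⊗-reflexive (*ᵣ-++ c s t)
        }
      ; *ₗ-*ᵣ-assoc = *ₗ-*ᵣ-assoc
      }
    }

open Tensor public using (tensorProduct)

-- `bisemimodule {R = R}` is R as a bimodule over itself.

record MoritaEquivalent {c ℓ : Level} (K L : KleeneAlgebra c ℓ) : Set (lsuc (c ⊔ ℓ)) where
  private
    module K = KleeneAlgebra K
    module L = KleeneAlgebra L

  field
    X : KleeneBimodule K L c ℓ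
    Y : KleeneBimodule L K c ℓ

  private
    module X = KleeneBimodule X
    module Y = KleeneBimodule Y

  field
    X⊗Y≅K : BimoduleIso (tensorProduct X.bimodule Y.bimodule) (bisemimodule {R = K.semiring})
    Y⊗X≅L : BimoduleIso (tensorProduct Y.bimodule X.bimodule) (bisemimodule {R = L.semiring})

module Order {c ℓ : Level} (K : KleeneAlgebra c ℓ) where
  open KleeneAlgebra K
  open Relation.Binary.Reasoning.Setoid setoid

  ≤-reflexive : ∀ {x y} → x ≈ y → x ≤ y
  ≤-reflexive {x} {y} p = trans (+-congʳ p) (+-idem y)

  ≤-trans : ∀ {x y z} → x ≤ y → y ≤ z → x ≤ z
  ≤-trans {x} {y} {z} p q = begin
    x + z        ≈⟨ +-congˡ q ⟨
    x + (y + z)  ≈⟨ +-assoc x y z ⟨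
    (x + y) + z  ≈⟨ +-congʳ p ⟩
    y + z        ≈⟨ q ⟩
    z            ∎

  ≤-antisym : ∀ {x y} → x ≤ y → y ≤ x → x ≈ y
  ≤-antisym {x} {y} p q = trans (sym q) (trans (+-comm y x) p)

  ≤-poset : Poset c ℓ ℓ
  ≤-poset = record
    { isPartialOrder = record
      { isPreorder = record
        { isEquivalence = isEquivalence
        ; reflexive     = ≤-reflexive
        ; trans         = ≤-trans
        }
      ; antisym = ≤-antisym
      }
    }

  x≤x+y : ∀ x y → x ≤ x + y
  x≤x+y x y = trans (sym (+-assoc x x y)) (+-congʳ (+-idem x))

  y≤x+y : ∀ x y → y ≤ x + y
  y≤x+y x y = ≤-trans (x≤x+y y x) (≤-reflexive (+-comm y x))

  +-lub : ∀ {x y z} → x ≤ z → y ≤ z → x + y ≤ z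
  +-lub {x} {y} {z} p q = trans (+-assoc x y z) (trans (+-congˡ q) p)

  +-mono : ∀ {x x′ y y′} → x ≤ x′ → y ≤ y′ → x + y ≤ x′ + y′
  +-mono p q = +-lub (≤-trans p (x≤x+y _ _)) (≤-trans q (y≤x+y _ _))

  *-monoʳ : ∀ x {y z} → y ≤ z → x * y ≤ x * z
  *-monoʳ x {y} {z} p = trans (sym (distribˡ x y z)) (*-congˡ p)

  *-monoˡ : ∀ x {y z} → y ≤ z → y * x ≤ z * x
  *-monoˡ x {y} {z} p = trans (sym (distribʳ x y z)) (*-congʳ p)

  ⋆-absorbˡ : ∀ a x → a * x ≤ x → a ⋆ * x ≤ x
  ⋆-absorbˡ a x p = ⋆-inductˡ x a x (+-lub (≤-reflexive refl) p)

  ⋆-absorbʳ : ∀ a x → x * a ≤ x → x * a ⋆ ≤ x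
  ⋆-absorbʳ a x p = ⋆-inductʳ x a x (+-lub (≤-reflexive refl) p)

module Matrix {κ ℓ : Level} (K : KleeneAlgebra κ ℓ) where
  open KleeneAlgebra K hiding (zero)
  open Order K
  open Algebra.Properties.Semiring.Sum semiring

  Mat : ℕ → Set κ
  Mat n = Fin n → Fin n → Carrier

  infix  4 _≈ₘ_
  infixl 6 _+ₘ_
  infixl 7 _*ₘ_ _·_ _▸_ _◂_
  infix  8 _⋆ₘ

  _≈ₘ_ : ∀ {n} → Rel (Mat n) ℓ
  A ≈ₘ B = ∀ i j → A i j ≈ B i j

  _+ₘ_ : ∀ {n} → Op₂ (Mat n)
  (A +ₘ B) i j = A i j + B i j

  _·_ : ∀ {n} → Vector Carrier n → Vector Carrier n → Carrier
  _·_ {n} x y = ∑[ i < n ] (x i * y i)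

  _▸_ : ∀ {n} → Mat n → Vector Carrier n → Vector Carrier n
  (A ▸ x) i = A i · x

  _◂_ : ∀ {n} → Vector Carrier n → Mat n → Vector Carrier n
  (x ◂ A) j = x · (λ i → A i j)

  _*ₘ_ : ∀ {n} → Op₂ (Mat n)
  (A *ₘ B) i j = A i · (λ k → B k j)

  0ₘ : ∀ {n} → Mat n
  0ₘ i j = 0#

  1ₘ : ∀ {n} → Mat n
  1ₘ zero    zero    = 1#
  1ₘ zero    (suc j) = 0#
  1ₘ (suc i) zero    = 0#
  1ₘ (suc i) (suc j) = 1ₘ i j

  -- Block decomposition with a of size 1 × 1 and d of size n × n.  Any other
  -- decomposition gives the same operation, the star of a Kleene algebra being
  -- determined by its semiring.  At size 1 the formula reads (a + 0#) ⋆.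

  _⋆ₘ : ∀ {n} → Op₁ (Mat n)
  _⋆ₘ {zero}  A = A
  _⋆ₘ {suc n} A = block
    where
    a : Carrier
    a = A zero zero

    b c : Vector Carrier n
    b j = A zero (suc j)
    c i = A (suc i) zero

    d d⋆ : Mat n
    d i j = A (suc i) (suc j)
    d⋆    = d ⋆ₘ

    f : Carrier
    f = (a + b · (d⋆ ▸ c)) ⋆

    block : Mat (suc n)
    block zero    zero    = f
    block zero    (suc j) = f * (b ◂ d⋆) j
    block (suc i) zero    = (d⋆ ▸ c) i * f
    block (suc i) (suc j) = d⋆ i j + (d⋆ ▸ c) i * (f * (b ◂ d⋆) j)

  private
    V : ℕ → Set κ
    V n = Vector Carrier n

  ·-cong : ∀ {n} {x x′ y y′ : V n} → (∀ i → x i ≈ x′ i) → (∀ i → y i ≈ y′ i) →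
           x · y ≈ x′ · y′
  ·-cong p q = sum-cong-≋ (λ i → *-cong (p i) (q i))

  ·-congˡ : ∀ {n} (x : V n) {y y′ : V n} → (∀ i → y i ≈ y′ i) → x · y ≈ x · y′
  ·-congˡ x = ·-cong (λ i → refl {x i})

  ·-congʳ : ∀ {n} (y : V n) {x x′ : V n} → (∀ i → x i ≈ x′ i) → x · y ≈ x′ · y
  ·-congʳ y p = ·-cong p (λ i → refl {y i})

  ·-distribˡ : ∀ {n} (x y z : V n) → x · (λ i → y i + z i) ≈ x · y + x · z
  ·-distribˡ x y z = trans (sum-cong-≋ (λ i → distribˡ (x i) (y i) (z i)))
                           (∑-distrib-+ (λ i → x i * y i) (λ i → x i * z i))

  ·-distribʳ : ∀ {n} (x y z : V n) → (λ i → y i + z i) · x ≈ y · x + z · x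
  ·-distribʳ x y z = trans (sum-cong-≋ (λ i → distribʳ (x i) (y i) (z i)))
                           (∑-distrib-+ (λ i → y i * x i) (λ i → z i * x i))

  *-·-assoc : ∀ {n} k (x y : V n) → (λ i → k * x i) · y ≈ k * (x · y)
  *-·-assoc k x y = trans (sum-cong-≋ (λ i → *-assoc k (x i) (y i)))
                          (sym (*-distribˡ-sum k (λ i → x i * y i)))

  ·-*-assoc : ∀ {n} (x y : V n) k → x · (λ i → y i * k) ≈ (x · y) * k
  ·-*-assoc x y k = trans (sum-cong-≋ (λ i → sym (*-assoc (x i) (y i) k)))
                          (sym (*-distribʳ-sum k (λ i → x i * y i)))

  ·-zeroˡ : ∀ {n} (x : V n) → (λ i → 0#) · x ≈ 0#
  ·-zeroˡ {n} x = trans (sum-cong-≋ (λ i → zeroˡ (x i))) (sum-replicate-zero n)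

  ·-zeroʳ : ∀ {n} (x : V n) → x · (λ i → 0#) ≈ 0#
  ·-zeroʳ {n} x = trans (sum-cong-≋ (λ i → zeroʳ (x i))) (sum-replicate-zero n)

  ◂-▸-assoc : ∀ {n} (x : V n) (A : Mat n) (y : V n) → (x ◂ A) · y ≈ x · (A ▸ y)
  ◂-▸-assoc x A y = begin
    sum (λ j → sum (λ i → x i * A i j) * y j)
      ≈⟨ sum-cong-≋ (λ j → *-distribʳ-sum (y j) (λ i → x i * A i j)) ⟩
    sum (λ j → sum (λ i → x i * A i j * y j))
      ≈⟨ ∑-comm (λ j i → x i * A i j * y j) ⟩
    sum (λ i → sum (λ j → x i * A i j * y j))
      ≈⟨ sum-cong-≋ (λ i → *-·-assoc (x i) (A i) y) ⟩
    sum (λ i → x i * sum (λ j → A i j * y j)) ∎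
    where open Relation.Binary.Reasoning.Setoid setoid

  1ₘ-identityˡ : ∀ {n} (x : V n) i → (1ₘ ▸ x) i ≈ x i
  1ₘ-identityˡ x zero = trans (+-cong (*-identityˡ (x zero)) (·-zeroˡ (λ i → x (suc i))))
                              (+-identityʳ (x zero))
  1ₘ-identityˡ x (suc i) = trans (+-cong (zeroˡ (x zero)) (1ₘ-identityˡ (λ i → x (suc i)) i))
                                 (+-identityˡ (x (suc i)))

  1ₘ-identityʳ : ∀ {n} (x : V n) i → (x ◂ 1ₘ) i ≈ x i
  1ₘ-identityʳ x zero = trans (+-cong (*-identityʳ (x zero)) (·-zeroʳ (λ i → x (suc i))))
                              (+-identityʳ (x zero))
  1ₘ-identityʳ x (suc i) = trans (+-cong (zeroʳ (x zero)) (1ₘ-identityʳ (λ i → x (suc i)) i))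
                                 (+-identityˡ (x (suc i)))

  matrixIdempotentSemiring : ℕ → IdempotentSemiring κ ℓ
  matrixIdempotentSemiring n = record
    { Carrier = Mat n
    ; _≈_     = _≈ₘ_
    ; _+_     = _+ₘ_
    ; _*_     = _*ₘ_
    ; 0#      = 0ₘ
    ; 1#      = 1ₘ
    ; isIdempotentSemiring = record
      { isSemiring = record
        { isSemiringWithoutAnnihilatingZero = record
          { +-isCommutativeMonoid = record
            { isMonoid = record
              { isSemigroup = record
                { isMagma = record
                  { isEquivalence = record
                    { refl  = λ i j → refl
                    ; sym   = λ p i j → sym (p i j)
                    ; trans = λ p q i j → trans (p i j) (q i j)
                    }
                  ; ∙-cong = λ p q i j → +-cong (p i j) (q i j)
                  }
                ; assoc = λ A B C i j → +-assoc (A i j) (B i j) (C i j)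
                }
              ; identity = (λ A i j → +-identityˡ (A i j))
                         , (λ A i j → +-identityʳ (A i j))
              }
            ; comm = λ A B i j → +-comm (A i j) (B i j)
            }
          ; *-cong     = λ p q i j → ·-cong (p i) (λ k → q k j)
          ; *-assoc    = λ A B C i j → ◂-▸-assoc (A i) B (λ k → C k j)
          ; *-identity = (λ A i j → 1ₘ-identityˡ (λ k → A k j) i)
                       , (λ A i j → 1ₘ-identityʳ (A i) j)
          ; distrib    = (λ A B C i j → ·-distribˡ (A i) (λ k → B k j) (λ k → C k j))
                       , (λ A B C i j → ·-distribʳ (λ k → A k j) (B i) (C i))
          }
        ; zero = (λ A i j → ·-zeroˡ (λ k → A k j)) , (λ A i j → ·-zeroʳ (A i))
        }
      ; +-idem = λ A i j → +-idem (A i j)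
      }
    }

  ·-monoʳ : ∀ {n} (x : V n) {y z : V n} → (∀ i → y i ≤ z i) → x · y ≤ x · z
  ·-monoʳ x {y} {z} p = trans (sym (·-distribˡ x y z)) (·-congˡ x p)

  ·-monoˡ : ∀ {n} (x : V n) {y z : V n} → (∀ i → y i ≤ z i) → y · x ≤ z · x
  ·-monoˡ x {y} {z} p = trans (sym (·-distribʳ x y z)) (·-congʳ x p)

  ⋆ₘ-unfoldˡ : ∀ {n} (A : Mat n) → 1ₘ +ₘ A *ₘ A ⋆ₘ ≈ₘ A ⋆ₘ
  ⋆ₘ-unfoldˡ {zero}  A ()
  ⋆ₘ-unfoldˡ {suc n} A = go
    where
    open Relation.Binary.Reasoning.Setoid setoid
    a : Carrier
    a = A zero zero
    b c : V n
    b j = A zero (suc j)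
    c i = A (suc i) zero
    d D : Mat n
    d i j = A (suc i) (suc j)
    D = d ⋆ₘ
    u v : V n
    u = D ▸ c
    v = b ◂ D
    f : Carrier
    f = (a + b · u) ⋆

    u-eq : ∀ i → c i + (d ▸ u) i ≈ u i
    u-eq i = begin
      c i + d i · u                        ≈⟨ +-cong (1ₘ-identityˡ c i) (◂-▸-assoc (d i) D c) ⟨
      1ₘ i · c + (d *ₘ D) i · c            ≈⟨ ·-distribʳ c (1ₘ i) ((d *ₘ D) i) ⟨
      (1ₘ +ₘ d *ₘ D) i · c                 ≈⟨ ·-congʳ c (⋆ₘ-unfoldˡ d i) ⟩
      D i · c                              ∎

    first : ∀ k → a * (f * k) + b · (λ i → u i * (f * k)) ≈ (a + b · u) * f * k
    first k = begin
      a * (f * k) + b · (λ i → u i * (f * k))  ≈⟨ +-congˡ (·-*-assoc b u (f * k)) ⟩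
      a * (f * k) + (b · u) * (f * k)          ≈⟨ distribʳ (f * k) a (b · u) ⟨
      (a + b · u) * (f * k)                    ≈⟨ *-assoc (a + b · u) f k ⟨
      (a + b · u) * f * k                      ∎

    other : ∀ i k → c i * k + d i · (λ l → u l * k) ≈ u i * k
    other i k = begin
      c i * k + d i · (λ l → u l * k)  ≈⟨ +-congˡ (·-*-assoc (d i) u k) ⟩
      c i * k + (d i · u) * k          ≈⟨ distribʳ k (c i) (d i · u) ⟨
      (c i + d i · u) * k              ≈⟨ *-congʳ (u-eq i) ⟩
      u i * k                          ∎

    split : ∀ (x y z : V n) k → k + x · (λ i → y i + z i) ≈ x · y + (k + x · z)
    split x y z k = begin
      k + x · (λ i → y i + z i)  ≈⟨ +-congˡ (·-distribˡ x y z) ⟩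
      k + (x · y + x · z)        ≈⟨ +-assoc k (x · y) (x · z) ⟨
      k + x · y + x · z          ≈⟨ +-congʳ (+-comm k (x · y)) ⟩
      x · y + k + x · z          ≈⟨ +-assoc (x · y) k (x · z) ⟩
      x · y + (k + x · z)        ∎

    go : 1ₘ +ₘ A *ₘ A ⋆ₘ ≈ₘ A ⋆ₘ
    go zero zero = begin
      1# + (a * f + b · (λ k → u k * f))  ≈⟨ +-congˡ (+-congˡ (·-*-assoc b u f)) ⟩
      1# + (a * f + (b · u) * f)          ≈⟨ +-congˡ (distribʳ f a (b · u)) ⟨
      1# + (a + b · u) * f                ≈⟨ ⋆-unfoldˡ (a + b · u) ⟩
      f                                   ∎
    go zero (suc j) = begin
      0# + (a * (f * v j) + b · (λ k → D k j + u k * (f * v j)))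
        ≈⟨ +-identityˡ _ ⟩
      a * (f * v j) + b · (λ k → D k j + u k * (f * v j))
        ≈⟨ split b (λ k → D k j) (λ k → u k * (f * v j)) (a * (f * v j)) ⟩
      v j + (a * (f * v j) + b · (λ k → u k * (f * v j)))
        ≈⟨ +-cong (sym (*-identityˡ (v j))) (first (v j)) ⟩
      1# * v j + (a + b · u) * f * v j
        ≈⟨ distribʳ (v j) 1# ((a + b · u) * f) ⟨
      (1# + (a + b · u) * f) * v j
        ≈⟨ *-congʳ (⋆-unfoldˡ (a + b · u)) ⟩
      f * v j ∎
    go (suc i) zero = trans (+-identityˡ _) (other i f)
    go (suc i) (suc j) = begin
      1ₘ i j + (c i * (f * v j) + d i · (λ k → D k j + u k * (f * v j)))
        ≈⟨ +-congˡ (split (d i) (λ k → D k j) (λ k → u k * (f * v j)) (c i * (f * v j))) ⟩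
      1ₘ i j + ((d *ₘ D) i j + (c i * (f * v j) + d i · (λ k → u k * (f * v j))))
        ≈⟨ +-assoc _ _ _ ⟨
      1ₘ i j + (d *ₘ D) i j + (c i * (f * v j) + d i · (λ k → u k * (f * v j)))
        ≈⟨ +-cong (⋆ₘ-unfoldˡ d i j) (other i (f * v j)) ⟩
      D i j + u i * (f * v j) ∎

  ⋆ₘ-unfoldʳ : ∀ {n} (A : Mat n) → 1ₘ +ₘ A ⋆ₘ *ₘ A ≈ₘ A ⋆ₘ
  ⋆ₘ-unfoldʳ {zero}  A ()
  ⋆ₘ-unfoldʳ {suc n} A = go
    where
    open Relation.Binary.Reasoning.Setoid setoid
    a : Carrier
    a = A zero zero
    b c : V n
    b j = A zero (suc j)
    c i = A (suc i) zero
    d D : Mat n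
    d i j = A (suc i) (suc j)
    D = d ⋆ₘ
    u v : V n
    u = D ▸ c
    v = b ◂ D
    f : Carrier
    f = (a + b · u) ⋆

    v-eq : ∀ j → b j + (v ◂ d) j ≈ v j
    v-eq j = begin
      b j + (v ◂ d) j
        ≈⟨ +-cong (1ₘ-identityʳ b j) (sym (◂-▸-assoc b D (λ k → d k j))) ⟨
      (b ◂ 1ₘ) j + (b ◂ (D *ₘ d)) j
        ≈⟨ ·-distribˡ b (λ k → 1ₘ k j) (λ k → (D *ₘ d) k j) ⟨
      b · (λ k → 1ₘ k j + (D *ₘ d) k j)
        ≈⟨ ·-congˡ b (λ k → ⋆ₘ-unfoldʳ d k j) ⟩
      v j ∎

    corner : f * a + (λ i → f * v i) · c ≈ f * (a + b · u)
    corner = begin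
      f * a + (λ i → f * v i) · c  ≈⟨ +-congˡ (*-·-assoc f v c) ⟩
      f * a + f * (v · c)          ≈⟨ +-congˡ (*-congˡ (◂-▸-assoc b D c)) ⟩
      f * a + f * (b · u)          ≈⟨ distribˡ f a (b · u) ⟨
      f * (a + b · u)              ∎

    first : ∀ k → k * f * a + (λ i → k * (f * v i)) · c ≈ k * (f * (a + b · u))
    first k = begin
      k * f * a + (λ i → k * (f * v i)) · c    ≈⟨ +-cong (*-assoc k f a) (*-·-assoc k (λ i → f * v i) c) ⟩
      k * (f * a) + k * ((λ i → f * v i) · c)  ≈⟨ distribˡ k _ _ ⟨
      k * (f * a + (λ i → f * v i) · c)        ≈⟨ *-congˡ corner ⟩
      k * (f * (a + b · u))                    ∎

    other : ∀ j → f * b j + ((λ i → f * v i) ◂ d) j ≈ f * v j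
    other j = begin
      f * b j + ((λ i → f * v i) ◂ d) j  ≈⟨ +-congˡ (*-·-assoc f v (λ k → d k j)) ⟩
      f * b j + f * (v ◂ d) j            ≈⟨ distribˡ f (b j) ((v ◂ d) j) ⟨
      f * (b j + (v ◂ d) j)              ≈⟨ *-congˡ (v-eq j) ⟩
      f * v j                            ∎

    split : ∀ (x y z : V n) k → k + (λ i → y i + z i) · x ≈ y · x + (k + z · x)
    split x y z k = begin
      k + (λ i → y i + z i) · x  ≈⟨ +-congˡ (·-distribʳ x y z) ⟩
      k + (y · x + z · x)        ≈⟨ +-assoc k (y · x) (z · x) ⟨
      k + y · x + z · x          ≈⟨ +-congʳ (+-comm k (y · x)) ⟩
      y · x + k + z · x          ≈⟨ +-assoc (y · x) k (z · x) ⟩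
      y · x + (k + z · x)        ∎

    go : 1ₘ +ₘ A ⋆ₘ *ₘ A ≈ₘ A ⋆ₘ
    go zero zero = trans (+-congˡ corner) (⋆-unfoldʳ (a + b · u))
    go zero (suc j) = trans (+-identityˡ _) (other j)
    go (suc i) zero = begin
      0# + (u i * f * a + (λ k → D i k + u i * (f * v k)) · c)
        ≈⟨ +-identityˡ _ ⟩
      u i * f * a + (λ k → D i k + u i * (f * v k)) · c
        ≈⟨ split c (D i) (λ k → u i * (f * v k)) (u i * f * a) ⟩
      u i + (u i * f * a + (λ k → u i * (f * v k)) · c)
        ≈⟨ +-cong (sym (*-identityʳ (u i))) (first (u i)) ⟩
      u i * 1# + u i * (f * (a + b · u))
        ≈⟨ distribˡ (u i) 1# _ ⟨
      u i * (1# + f * (a + b · u))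
        ≈⟨ *-congˡ (⋆-unfoldʳ (a + b · u)) ⟩
      u i * f ∎
    go (suc i) (suc j) = begin
      1ₘ i j + (u i * f * b j + (λ k → D i k + u i * (f * v k)) · dⱼ)
        ≈⟨ +-congˡ (split dⱼ (D i) (λ k → u i * (f * v k)) (u i * f * b j)) ⟩
      1ₘ i j + ((D *ₘ d) i j + (u i * f * b j + (λ k → u i * (f * v k)) · dⱼ))
        ≈⟨ +-assoc _ _ _ ⟨
      1ₘ i j + (D *ₘ d) i j + (u i * f * b j + (λ k → u i * (f * v k)) · dⱼ)
        ≈⟨ +-cong (⋆ₘ-unfoldʳ d i j)
                  (+-cong (*-assoc (u i) f (b j)) (*-·-assoc (u i) (λ k → f * v k) dⱼ)) ⟩
      D i j + (u i * (f * b j) + u i * ((λ k → f * v k) · dⱼ))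
        ≈⟨ +-congˡ (distribˡ (u i) _ _) ⟨
      D i j + u i * (f * b j + (λ k → f * v k) · dⱼ)
        ≈⟨ +-congˡ (*-congˡ (other j)) ⟩
      D i j + u i * (f * v j) ∎
      where
      dⱼ : V n
      dⱼ k = d k j

  ⋆ₘ-absorbˡ : ∀ {n} (A : Mat n) (z : V n) →
               (∀ i → (A ▸ z) i ≤ z i) → ∀ i → (A ⋆ₘ ▸ z) i ≤ z i
  ⋆ₘ-absorbˡ {zero}  A z Az≤z ()
  ⋆ₘ-absorbˡ {suc n} A z Az≤z = go
    where
    open Relation.Binary.Reasoning.PartialOrder ≤-poset
    a x : Carrier
    a = A zero zero
    x = z zero
    b c y : V n
    b j = A zero (suc j)
    c i = A (suc i) zero
    y i = z (suc i)
    d D : Mat n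
    d i j = A (suc i) (suc j)
    D = d ⋆ₘ
    u v : V n
    u = D ▸ c
    v = b ◂ D
    f : Carrier
    f = (a + b · u) ⋆

    ax≤x : a * x ≤ x
    ax≤x = ≤-trans (x≤x+y _ _) (Az≤z zero)

    by≤x : b · y ≤ x
    by≤x = ≤-trans (y≤x+y _ _) (Az≤z zero)

    cx≤y : ∀ i → c i * x ≤ y i
    cx≤y i = ≤-trans (x≤x+y _ _) (Az≤z (suc i))

    Dy≤y : ∀ i → (D ▸ y) i ≤ y i
    Dy≤y = ⋆ₘ-absorbˡ d y (λ i → ≤-trans (y≤x+y _ _) (Az≤z (suc i)))

    ux≤y : ∀ i → u i * x ≤ y i
    ux≤y i = begin
      u i * x                ≈⟨ ·-*-assoc (D i) c x ⟨
      D i · (λ k → c k * x)  ≤⟨ ·-monoʳ (D i) cx≤y ⟩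
      D i · y                ≤⟨ Dy≤y i ⟩
      y i                    ∎

    fx≤x : f * x ≤ x
    fx≤x = ⋆-absorbˡ (a + b · u) x (begin
      (a + b · u) * x              ≈⟨ distribʳ x a (b · u) ⟩
      a * x + (b · u) * x          ≈⟨ +-congˡ (·-*-assoc b u x) ⟨
      a * x + b · (λ i → u i * x)  ≤⟨ +-lub ax≤x (≤-trans (·-monoʳ b ux≤y) by≤x) ⟩
      x                            ∎)

    fvy≤x : f * (v · y) ≤ x
    fvy≤x = begin
      f * (v · y)        ≈⟨ *-congˡ (◂-▸-assoc b D y) ⟩
      f * (b · (D ▸ y))  ≤⟨ *-monoʳ f (≤-trans (·-monoʳ b Dy≤y) by≤x) ⟩
      f * x              ≤⟨ fx≤x ⟩
      x                  ∎

    go : ∀ i → (A ⋆ₘ ▸ z) i ≤ z i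
    go zero = begin
      f * x + (λ k → f * v k) · y  ≈⟨ +-congˡ (*-·-assoc f v y) ⟩
      f * x + f * (v · y)          ≤⟨ +-lub fx≤x fvy≤x ⟩
      x                            ∎
    go (suc i) = begin
      u i * f * x + (λ k → D i k + u i * (f * v k)) · y
        ≈⟨ +-congˡ (·-distribʳ y (D i) (λ k → u i * (f * v k))) ⟩
      u i * f * x + (D i · y + (λ k → u i * (f * v k)) · y)
        ≈⟨ +-cong (*-assoc (u i) f x)
             (+-congˡ (trans (*-·-assoc (u i) (λ k → f * v k) y)
                             (*-congˡ (*-·-assoc f v y)))) ⟩
      u i * (f * x) + (D i · y + u i * (f * (v · y)))
        ≤⟨ +-lub (≤-trans (*-monoʳ (u i) fx≤x) (ux≤y i))
             (+-lub (Dy≤y i) (≤-trans (*-monoʳ (u i) fvy≤x) (ux≤y i))) ⟩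
      y i ∎

  ⋆ₘ-absorbʳ : ∀ {n} (A : Mat n) (z : V n) →
               (∀ i → (z ◂ A) i ≤ z i) → ∀ i → (z ◂ A ⋆ₘ) i ≤ z i
  ⋆ₘ-absorbʳ {zero}  A z zA≤z ()
  ⋆ₘ-absorbʳ {suc n} A z zA≤z = go
    where
    open Relation.Binary.Reasoning.PartialOrder ≤-poset
    a x : Carrier
    a = A zero zero
    x = z zero
    b c y : V n
    b j = A zero (suc j)
    c i = A (suc i) zero
    y i = z (suc i)
    d D : Mat n
    d i j = A (suc i) (suc j)
    D = d ⋆ₘ
    u v : V n
    u = D ▸ c
    v = b ◂ D
    f : Carrier
    f = (a + b · u) ⋆

    xa≤x : x * a ≤ x
    xa≤x = ≤-trans (x≤x+y _ _) (zA≤z zero)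

    yc≤x : y · c ≤ x
    yc≤x = ≤-trans (y≤x+y _ _) (zA≤z zero)

    xb≤y : ∀ j → x * b j ≤ y j
    xb≤y j = ≤-trans (x≤x+y _ _) (zA≤z (suc j))

    yD≤y : ∀ j → (y ◂ D) j ≤ y j
    yD≤y = ⋆ₘ-absorbʳ d y (λ j → ≤-trans (y≤x+y _ _) (zA≤z (suc j)))

    xv≤y : ∀ j → x * v j ≤ y j
    xv≤y j = begin
      x * v j                          ≈⟨ *-·-assoc x b (λ k → D k j) ⟨
      (λ k → x * b k) · (λ k → D k j)  ≤⟨ ·-monoˡ (λ k → D k j) xb≤y ⟩
      (y ◂ D) j                        ≤⟨ yD≤y j ⟩
      y j                              ∎

    xf≤x : x * f ≤ x
    xf≤x = ⋆-absorbʳ (a + b · u) x (begin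
      x * (a + b · u)              ≈⟨ distribˡ x a (b · u) ⟩
      x * a + x * (b · u)          ≈⟨ +-congˡ (*-congˡ (◂-▸-assoc b D c)) ⟨
      x * a + x * (v · c)          ≈⟨ +-congˡ (*-·-assoc x v c) ⟨
      x * a + (λ i → x * v i) · c  ≤⟨ +-lub xa≤x (≤-trans (·-monoˡ c xv≤y) yc≤x) ⟩
      x                            ∎)

    yuf≤x : (y · u) * f ≤ x
    yuf≤x = begin
      (y · u) * f        ≈⟨ *-congʳ (◂-▸-assoc y D c) ⟨
      ((y ◂ D) · c) * f  ≤⟨ *-monoˡ f (≤-trans (·-monoˡ c yD≤y) yc≤x) ⟩
      x * f              ≤⟨ xf≤x ⟩
      x                  ∎

    go : ∀ i → (z ◂ A ⋆ₘ) i ≤ z i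
    go zero = begin
      x * f + y · (λ k → u k * f)  ≈⟨ +-congˡ (·-*-assoc y u f) ⟩
      x * f + (y · u) * f          ≤⟨ +-lub xf≤x yuf≤x ⟩
      x                            ∎
    go (suc j) = begin
      x * (f * v j) + y · (λ k → D k j + u k * (f * v j))
        ≈⟨ +-congˡ (·-distribˡ y (λ k → D k j) (λ k → u k * (f * v j))) ⟩
      x * (f * v j) + ((y ◂ D) j + y · (λ k → u k * (f * v j)))
        ≈⟨ +-cong (sym (*-assoc x f (v j)))
             (+-congˡ (trans (·-*-assoc y u (f * v j))
                             (sym (*-assoc (y · u) f (v j))))) ⟩
      x * f * v j + ((y ◂ D) j + (y · u) * f * v j)
        ≤⟨ +-lub (≤-trans (*-monoˡ (v j) xf≤x) (xv≤y j))
             (+-lub (yD≤y j) (≤-trans (*-monoˡ (v j) yuf≤x) (xv≤y j))) ⟩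
      y j ∎

  matrixKleeneAlgebra : ℕ → KleeneAlgebra κ ℓ
  matrixKleeneAlgebra n = record
    { idempotentSemiring = matrixIdempotentSemiring n
    ; _⋆        = _⋆ₘ
    ; ⋆-unfoldˡ = ⋆ₘ-unfoldˡ
    ; ⋆-unfoldʳ = ⋆ₘ-unfoldʳ
    ; ⋆-inductˡ = λ X A Z p i j → ≤-trans
        (·-monoʳ ((A ⋆ₘ) i) (λ k → ≤-trans (x≤x+y _ _) (p k j)))
        (⋆ₘ-absorbˡ A (λ k → Z k j) (λ k → ≤-trans (y≤x+y _ _) (p k j)) i)
    ; ⋆-inductʳ = λ X A Z p i j → ≤-trans
        (·-monoˡ (λ k → (A ⋆ₘ) k j) (λ k → ≤-trans (x≤x+y _ _) (p i k)))
        (⋆ₘ-absorbʳ A (Z i) (λ k → ≤-trans (y≤x+y _ _) (p i k)) j)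
    }

open Matrix public using (matrixKleeneAlgebra)

{-# OPTIONS --safe #-}

-- X consists of row vectors and Y of column vectors.  The inner product
-- X × Y → K and the outer product Y × X → M form a Morita context, and either
-- tensor product maps isomorphically onto its semiring as soon as some formal
-- sum u has value 1: the inverse is k ↦ k u.  For the inner product
-- u = e₀ ⊗ e₀, which is where n ≠ 0 is needed; for the outer product
-- u = Σᵢ eᵢ ⊗ eᵢ.

module Submission where

open import Defs
open import Level using (Level; _⊔_)
open import Algebra.Bundles using (Semiring)
open import Algebra.Module.Bundles using (Bisemimodule)
open import Algebra.Module.Construct.TensorUnit using (bisemimodule)
import Algebra.Properties.Semiring.Sum
open import Data.Fin.Base using (Fin; zero; suc)
open import Data.List.Base using ([]; _∷_; [_]; _++_; tabulate)
open import Data.Nat.Base using (ℕ; zero; suc; NonZero)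
open import Data.Product.Base using (_×_; _,_; proj₁; proj₂)
open import Data.Vec.Functional using (Vector)
import Relation.Binary.Reasoning.Setoid

-- Morita contexts.

-- One half of a Morita context: ⟨_,_⟩ is a homomorphism X ⊗ Y → A, while of
-- ⟪_,_⟫ only the compatibility with ⟨_,_⟩ is required.

record Pairing {a ℓa b ℓb x ℓx y ℓy : Level}
               {A : Semiring a ℓa} {B : Semiring b ℓb}
               (X : Bisemimodule A B x ℓx) (Y : Bisemimodule B A y ℓy)
               : Set (a ⊔ ℓa ⊔ b ⊔ x ⊔ ℓx ⊔ y ⊔ ℓy) where
  private
    module A = Semiring A
    module B = Semiring B
    module X = Bisemimodule X
    module Y = Bisemimodule Y

  field
    ⟨_,_⟩     : X.Carrierᴹ → Y.Carrierᴹ → A.Carrier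
    ⟪_,_⟫     : Y.Carrierᴹ → X.Carrierᴹ → B.Carrier
    ⟨⟩-cong   : ∀ {x x′ y y′} → x X.≈ᴹ x′ → y Y.≈ᴹ y′ → ⟨ x , y ⟩ A.≈ ⟨ x′ , y′ ⟩
    distribʳ  : ∀ x x′ y → ⟨ x X.+ᴹ x′ , y ⟩ A.≈ ⟨ x , y ⟩ A.+ ⟨ x′ , y ⟩
    distribˡ  : ∀ x y y′ → ⟨ x , y Y.+ᴹ y′ ⟩ A.≈ ⟨ x , y ⟩ A.+ ⟨ x , y′ ⟩
    zeroˡ     : ∀ y → ⟨ X.0ᴹ , y ⟩ A.≈ A.0#
    zeroʳ     : ∀ x → ⟨ x , Y.0ᴹ ⟩ A.≈ A.0#
    balanced  : ∀ x b y → ⟨ x X.*ᵣ b , y ⟩ A.≈ ⟨ x , b Y.*ₗ y ⟩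
    *ₗ-homo   : ∀ a x y → ⟨ a X.*ₗ x , y ⟩ A.≈ a A.* ⟨ x , y ⟩
    *ᵣ-homo   : ∀ x y a → ⟨ x , y Y.*ᵣ a ⟩ A.≈ ⟨ x , y ⟩ A.* a
    X-context : ∀ x y x′ → ⟨ x , y ⟩ X.*ₗ x′ X.≈ᴹ x X.*ᵣ ⟪ y , x′ ⟫
    Y-context : ∀ y x y′ → ⟪ y , x ⟫ Y.*ₗ y′ Y.≈ᴹ y Y.*ᵣ ⟨ x , y′ ⟩

-- Evaluation of formal sums and its inverse.

module _ {a ℓa b ℓb x ℓx y ℓy : Level}
         {A : Semiring a ℓa} {B : Semiring b ℓb}
         {X : Bisemimodule A B x ℓx} {Y : Bisemimodule B A y ℓy}
         (P : Pairing X Y) where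
  private
    module A = Semiring A
    module X = Bisemimodule X
    module Y = Bisemimodule Y
    module P = Pairing P
    open P using (⟨_,_⟩; ⟪_,_⟫)
    open Tensor X Y hiding (tensorProduct)
    module X⊗Y = Bisemimodule (tensorProduct X Y)

  eval : FormalSum → A.Carrier
  eval []            = A.0#
  eval ((x , y) ∷ s) = ⟨ x , y ⟩ A.+ eval s

  eval-[] : ∀ x y → eval [ (x , y) ] A.≈ ⟨ x , y ⟩
  eval-[] x y = A.+-identityʳ ⟨ x , y ⟩

  eval-++ : ∀ s t → eval (s ++ t) A.≈ eval s A.+ eval t
  eval-++ []            t = A.sym (A.+-identityˡ (eval t))
  eval-++ ((x , y) ∷ s) t =
    A.trans (A.+-congˡ (eval-++ s t)) (A.sym (A.+-assoc ⟨ x , y ⟩ (eval s) (eval t)))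

  eval-*ₗ : ∀ a s → eval (a *ₗ s) A.≈ a A.* eval s
  eval-*ₗ a []            = A.sym (A.zeroʳ a)
  eval-*ₗ a ((x , y) ∷ s) =
    A.trans (A.+-cong (P.*ₗ-homo a x y) (eval-*ₗ a s)) (A.sym (A.distribˡ a ⟨ x , y ⟩ (eval s)))

  eval-*ᵣ : ∀ a s → eval (s *ᵣ a) A.≈ eval s A.* a
  eval-*ᵣ a []            = A.sym (A.zeroˡ a)
  eval-*ᵣ a ((x , y) ∷ s) =
    A.trans (A.+-cong (P.*ᵣ-homo x y a) (eval-*ᵣ a s)) (A.sym (A.distribʳ a ⟨ x , y ⟩ (eval s)))

  -- Induction on the derivation: each generating relation of the tensor product is matched by a law
  -- of the pairing or of addition in `A`, so `eval` descends to the quotient.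
  eval-cong : ∀ {s t} → s ≈⊗ t → eval s A.≈ eval t
  eval-cong ⊗-refl        = A.refl
  eval-cong (⊗-sym p)     = A.sym (eval-cong p)
  eval-cong (⊗-trans p q) = A.trans (eval-cong p) (eval-cong q)
  eval-cong (⊗-++-cong {s} {s′} {t} {t′} p q) = begin
    eval (s ++ t)          ≈⟨ eval-++ s t ⟩
    eval s A.+ eval t      ≈⟨ A.+-cong (eval-cong p) (eval-cong q) ⟩
    eval s′ A.+ eval t′    ≈⟨ eval-++ s′ t′ ⟨
    eval (s′ ++ t′)        ∎
    where open Relation.Binary.Reasoning.Setoid A.setoid
  eval-cong (⊗-comm s t) = begin
    eval (s ++ t)          ≈⟨ eval-++ s t ⟩
    eval s A.+ eval t      ≈⟨ A.+-comm (eval s) (eval t) ⟩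
    eval t A.+ eval s      ≈⟨ eval-++ t s ⟨
    eval (t ++ s)          ∎
    where open Relation.Binary.Reasoning.Setoid A.setoid
  -- A singleton evaluates to its value plus a trailing `0#`; the generator cases carry it along,
  -- except the zero cases, which strip it by `eval-[]`.
  eval-cong (⊗-cong p q)         = A.+-congʳ (P.⟨⟩-cong p q)
  eval-cong (⊗-distribʳ x x′ y)  =
    A.trans (A.+-congʳ (P.distribʳ x x′ y)) (A.+-assoc _ _ _)
  eval-cong (⊗-distribˡ x y y′)  =
    A.trans (A.+-congʳ (P.distribˡ x y y′)) (A.+-assoc _ _ _)
  eval-cong (⊗-zeroˡ y)          = A.trans (eval-[] _ _) (P.zeroˡ y)
  eval-cong (⊗-zeroʳ x)          = A.trans (eval-[] _ _) (P.zeroʳ x)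
  eval-cong (⊗-balanced x b y)   = A.+-congʳ (P.balanced x b y)

  -- The scalar crosses the tensor sign term by term: `X-context` rewrites it as a right action of
  -- `⟪ y , x′ ⟫`, balancing moves that to the other factor, and `Y-context` turns it into a right
  -- action on `y`. The first factor is then the constant `x`, so the terms merge into one.
  ⟨⟩-*ₗ : ∀ x y u → ⟨ x , y ⟩ *ₗ u ≈⊗ [ (x , y Y.*ᵣ eval u) ]
  ⟨⟩-*ₗ x y [] = ⊗-sym (⊗-trans (⊗-cong X.≈ᴹ-refl (Y.*ᵣ-zeroʳ y)) (⊗-zeroʳ x))
  ⟨⟩-*ₗ x y ((x′ , y′) ∷ u) = begin
    (⟨ x , y ⟩ X.*ₗ x′ , y′) ∷ ⟨ x , y ⟩ *ₗ u
      ≈⟨ ⊗-++-cong (⊗-cong (P.X-context x y x′) Y.≈ᴹ-refl) (⟨⟩-*ₗ x y u) ⟩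
    (x X.*ᵣ ⟪ y , x′ ⟫ , y′) ∷ (x , y Y.*ᵣ eval u) ∷ []
      ≈⟨ ⊗-++-cong (⊗-balanced x ⟪ y , x′ ⟫ y′) ⊗-refl ⟩
    (x , ⟪ y , x′ ⟫ Y.*ₗ y′) ∷ (x , y Y.*ᵣ eval u) ∷ []
      ≈⟨ ⊗-++-cong (⊗-cong X.≈ᴹ-refl (P.Y-context y x′ y′)) ⊗-refl ⟩
    (x , y Y.*ᵣ ⟨ x′ , y′ ⟩) ∷ (x , y Y.*ᵣ eval u) ∷ []
      ≈⟨ ⊗-distribˡ x _ _ ⟨
    [ (x , y Y.*ᵣ ⟨ x′ , y′ ⟩ Y.+ᴹ y Y.*ᵣ eval u) ]
      ≈⟨ ⊗-cong X.≈ᴹ-refl (Y.*ᵣ-distribˡ y ⟨ x′ , y′ ⟩ (eval u)) ⟨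
    [ (x , y Y.*ᵣ (⟨ x′ , y′ ⟩ A.+ eval u)) ] ∎
    where open Relation.Binary.Reasoning.Setoid X⊗Y.≈ᴹ-setoid

  module _ (u : FormalSum) (eval-u : eval u A.≈ A.1#) where

    eval-*ₗ-unit : ∀ a → eval (a *ₗ u) A.≈ a
    eval-*ₗ-unit a = A.trans (eval-*ₗ a u) (A.trans (A.*-congˡ eval-u) (A.*-identityʳ a))

    -- A formal sum is recovered from its value, so `eval` is injective up to `≈⊗`.
    *ₗ-unit-eval : ∀ s → eval s *ₗ u ≈⊗ s
    *ₗ-unit-eval []            = X⊗Y.*ₗ-zeroˡ u
    *ₗ-unit-eval ((x , y) ∷ s) = begin
      (⟨ x , y ⟩ A.+ eval s) *ₗ u          ≈⟨ X⊗Y.*ₗ-distribʳ u ⟨ x , y ⟩ (eval s) ⟩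
      ⟨ x , y ⟩ *ₗ u ++ eval s *ₗ u        ≈⟨ ⊗-++-cong (⟨⟩-*ₗ x y u) (*ₗ-unit-eval s) ⟩
      (x , y Y.*ᵣ eval u) ∷ s              ≈⟨ ⊗-++-cong (⊗-cong X.≈ᴹ-refl y*eval-u≈y) ⊗-refl ⟩
      (x , y) ∷ s                          ∎
      where
      open Relation.Binary.Reasoning.Setoid X⊗Y.≈ᴹ-setoid
      y*eval-u≈y : y Y.*ᵣ eval u Y.≈ᴹ y
      y*eval-u≈y = Y.≈ᴹ-trans (Y.*ᵣ-congˡ eval-u) (Y.*ᵣ-identityʳ y)

    -- Right linearity of `_*ₗ u` is not immediate, as scalars enter `u` from the left. Both sides
    -- have the value `a′ * a`, and `*ₗ-unit-eval` recovers a sum from its value.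
    *ₗ-unit-*ᵣ : ∀ a a′ → (a′ A.* a) *ₗ u ≈⊗ (a′ *ₗ u) *ᵣ a
    *ₗ-unit-*ᵣ a a′ = begin
      (a′ A.* a) *ₗ u               ≈⟨ X⊗Y.*ₗ-congʳ (A.*-congʳ (eval-*ₗ-unit a′)) ⟨
      (eval (a′ *ₗ u) A.* a) *ₗ u   ≈⟨ X⊗Y.*ₗ-congʳ (eval-*ᵣ a (a′ *ₗ u)) ⟨
      eval ((a′ *ₗ u) *ᵣ a) *ₗ u    ≈⟨ *ₗ-unit-eval ((a′ *ₗ u) *ᵣ a) ⟩
      (a′ *ₗ u) *ᵣ a                ∎
      where open Relation.Binary.Reasoning.Setoid X⊗Y.≈ᴹ-setoid

    unit⇒iso : BimoduleIso (tensorProduct X Y) (bisemimodule {R = A})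
    unit⇒iso = record
      { to   = eval
      ; from = _*ₗ u
      ; to-homo = record
        { +ᴹ-isMonoidHomomorphism = record
          { isMagmaHomomorphism = record
            { isRelHomomorphism = record { cong = eval-cong }
            ; homo              = eval-++
            }
          ; ε-homo = A.refl
          }
        ; *ₗ-homo = eval-*ₗ
        ; *ᵣ-homo = eval-*ᵣ
        }
      ; from-homo = record
        { +ᴹ-isMonoidHomomorphism = record
          { isMagmaHomomorphism = record
            { isRelHomomorphism = record { cong = λ p → X⊗Y.*ₗ-congʳ p }
            ; homo              = X⊗Y.*ₗ-distribʳ u
            }
          ; ε-homo = X⊗Y.*ₗ-zeroˡ u
          }
        ; *ₗ-homo = λ a a′ → X⊗Y.*ₗ-assoc a a′ u
        ; *ᵣ-homo = *ₗ-unit-*ᵣ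
        }
      ; inverse = (λ {a} {s} s≈ → A.trans (eval-cong s≈) (eval-*ₗ-unit a))
                , (λ {s} {a} a≈ → ⊗-trans (X⊗Y.*ₗ-congʳ a≈) (*ₗ-unit-eval s))
      }

  eval-tabulate : ∀ {n} (f : Fin n → X.Carrierᴹ × Y.Carrierᴹ) →
                  eval (tabulate f) A.≈
                  Algebra.Properties.Semiring.Sum.sum A (λ i → ⟨ proj₁ (f i) , proj₂ (f i) ⟩)
  eval-tabulate {zero}  f = A.refl
  eval-tabulate {suc n} f = A.+-congˡ (eval-tabulate (λ i → f (suc i)))

-- Row and column vectors as Kleene bimodules.

module VectorModules {c ℓ : Level} (K : KleeneAlgebra c ℓ) (n : ℕ) where
  open KleeneAlgebra K hiding (zero)
  open Order K
  open Matrix K hiding (matrixKleeneAlgebra)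
  open Algebra.Properties.Semiring.Sum semiring using (sum)

  private
    M : KleeneAlgebra c ℓ
    M = matrixKleeneAlgebra K n
    module M = KleeneAlgebra M

    V : Set c
    V = Vector Carrier n

  rowBimodule : KleeneBimodule K M c ℓ
  rowBimodule = record
    { bimodule = record
      { Carrierᴹ = V
      ; _≈ᴹ_ = λ x y → ∀ i → x i ≈ y i
      ; _+ᴹ_ = λ x y i → x i + y i
      ; _*ₗ_ = λ k x i → k * x i
      ; _*ᵣ_ = _◂_
      ; 0ᴹ   = λ i → 0#
      ; isBisemimodule = record
        { +ᴹ-isCommutativeMonoid = record
          { isMonoid = record
            { isSemigroup = record
              { isMagma = record
                { isEquivalence = record
                  { refl  = λ i → refl
                  ; sym   = λ p i → sym (p i)
                  ; trans = λ p q i → trans (p i) (q i)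
                  }
                ; ∙-cong = λ p q i → +-cong (p i) (q i)
                }
              ; assoc = λ x y z i → +-assoc (x i) (y i) (z i)
              }
            ; identity = (λ x i → +-identityˡ (x i)) , (λ x i → +-identityʳ (x i))
            }
          ; comm = λ x y i → +-comm (x i) (y i)
          }
        ; isPreleftSemimodule = record
          { *ₗ-cong      = λ p q i → *-cong p (q i)
          ; *ₗ-zeroˡ     = λ x i → zeroˡ (x i)
          ; *ₗ-distribʳ  = λ x k l i → distribʳ (x i) k l
          ; *ₗ-identityˡ = λ x i → *-identityˡ (x i)
          ; *ₗ-assoc     = λ k l x i → *-assoc k l (x i)
          ; *ₗ-zeroʳ     = λ k i → zeroʳ k
          ; *ₗ-distribˡ  = λ k x y i → distribˡ k (x i) (y i)
          }
        ; isPrerightSemimodule = record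
          { *ᵣ-cong      = λ p q j → ·-cong p (λ i → q i j)
          ; *ᵣ-zeroʳ     = λ x j → ·-zeroʳ x
          ; *ᵣ-distribˡ  = λ x A B j → ·-distribˡ x (λ i → A i j) (λ i → B i j)
          ; *ᵣ-identityʳ = 1ₘ-identityʳ
          ; *ᵣ-assoc     = λ x A B j → ◂-▸-assoc x A (λ i → B i j)
          ; *ᵣ-zeroˡ     = λ A j → ·-zeroˡ (λ i → A i j)
          ; *ᵣ-distribʳ  = λ A x y j → ·-distribʳ (λ i → A i j) x y
          }
        ; *ₗ-*ᵣ-assoc = λ k x A j → *-·-assoc k x (λ i → A i j)
        }
      }
    -- The order on vectors is pointwise, so the scalar star is absorbed entry by entry; the matrix
    -- condition is exactly `⋆ₘ-absorbʳ`.
    ; isLeftKleeneModule  = λ k x kx≤x i → ⋆-absorbˡ k (x i) (kx≤x i)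
    ; isRightKleeneModule = ⋆ₘ-absorbʳ
    }

  columnBimodule : KleeneBimodule M K c ℓ
  columnBimodule = record
    { bimodule = record
      { _*ₗ_ = _▸_
      ; _*ᵣ_ = λ x k i → x i * k
      ; isBisemimodule = record
        -- Rows and columns share one additive monoid; unification reads the omitted carrier,
        -- equality, addition and zero off this field.
        { +ᴹ-isCommutativeMonoid = KleeneBimodule.+ᴹ-isCommutativeMonoid rowBimodule
        ; isPreleftSemimodule = record
          { *ₗ-cong      = λ p q i → ·-cong (p i) q
          ; *ₗ-zeroˡ     = λ x i → ·-zeroˡ x
          ; *ₗ-distribʳ  = λ x A B i → ·-distribʳ x (A i) (B i)
          ; *ₗ-identityˡ = 1ₘ-identityˡ
          ; *ₗ-assoc     = λ A B x i → ◂-▸-assoc (A i) B x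
          ; *ₗ-zeroʳ     = λ A i → ·-zeroʳ (A i)
          ; *ₗ-distribˡ  = λ A x y i → ·-distribˡ (A i) x y
          }
        ; isPrerightSemimodule = record
          { *ᵣ-cong      = λ p q i → *-cong (p i) q
          ; *ᵣ-zeroʳ     = λ x i → zeroʳ (x i)
          ; *ᵣ-distribˡ  = λ x k l i → distribˡ (x i) k l
          ; *ᵣ-identityʳ = λ x i → *-identityʳ (x i)
          ; *ᵣ-assoc     = λ x k l i → *-assoc (x i) k l
          ; *ᵣ-zeroˡ     = λ k i → zeroˡ k
          ; *ᵣ-distribʳ  = λ k x y i → distribʳ k (x i) (y i)
          }
        ; *ₗ-*ᵣ-assoc = λ A x k i → sym (·-*-assoc (A i) x k)
        }
      }
    ; isLeftKleeneModule  = ⋆ₘ-absorbˡ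
    ; isRightKleeneModule = λ k x xk≤x i → ⋆-absorbʳ k (x i) (xk≤x i)
    }

  private
    module Row = KleeneBimodule rowBimodule
    module Column = KleeneBimodule columnBimodule

  -- Inner and outer products as pairings.

  outer : V → V → Mat n
  outer y x i j = y i * x j

  innerPairing : Pairing Row.bimodule Column.bimodule
  innerPairing = record
    { ⟨_,_⟩     = _·_
    ; ⟪_,_⟫     = outer
    ; ⟨⟩-cong   = ·-cong
    ; distribʳ  = λ x x′ y → ·-distribʳ y x x′
    ; distribˡ  = ·-distribˡ
    ; zeroˡ     = ·-zeroˡ
    ; zeroʳ     = ·-zeroʳ
    ; balanced  = ◂-▸-assoc
    ; *ₗ-homo   = *-·-assoc
    ; *ᵣ-homo   = ·-*-assoc
    -- The context laws are associativity of the products row-column-row and column-row-column.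
    ; X-context = λ x y x′ j → sym (·-*-assoc x y (x′ j))
    ; Y-context = λ y x y′ i → *-·-assoc (y i) x y′
    }

  outerPairing : Pairing Column.bimodule Row.bimodule
  outerPairing = record
    { ⟨_,_⟩     = outer
    ; ⟪_,_⟫     = _·_
    ; ⟨⟩-cong   = λ p q i j → *-cong (p i) (q j)
    ; distribʳ  = λ y y′ x i j → distribʳ (x j) (y i) (y′ i)
    ; distribˡ  = λ y x x′ i j → distribˡ (y i) (x j) (x′ j)
    ; zeroˡ     = λ x i j → zeroˡ (x j)
    ; zeroʳ     = λ y i j → zeroʳ (y i)
    ; balanced  = λ y k x i j → *-assoc (y i) k (x j)
    ; *ₗ-homo   = λ A y x i j → sym (·-*-assoc (A i) y (x j))
    ; *ᵣ-homo   = λ y x A i j → sym (*-·-assoc (y i) x (λ k → A k j))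
    -- The two context laws of `innerPairing` with their roles exchanged.
    ; X-context = λ y x y′ i → *-·-assoc (y i) x y′
    ; Y-context = λ x y x′ j → sym (·-*-assoc x y (x′ j))
    }

  -- Units and the two isomorphisms.

  -- Links the matrix-valued sum coming from `eval-tabulate` to the scalar sums of the vector
  -- lemmas.
  sumₘ-entry : ∀ {m} (A : Fin m → Mat n) i j →
               Algebra.Properties.Semiring.Sum.sum M.semiring A i j ≈ sum (λ k → A k i j)
  sumₘ-entry {zero}  A i j = refl
  sumₘ-entry {suc m} A i j = +-congˡ (sumₘ-entry (λ k → A (suc k)) i j)

  column⊗row≅M : BimoduleIso (tensorProduct Column.bimodule Row.bimodule)
                             (bisemimodule {R = M.semiring})
  column⊗row≅M = unit⇒iso outerPairing (tabulate basis) λ i j →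
    trans (eval-tabulate outerPairing basis i j)
      (trans (sumₘ-entry (λ k → outer (λ i → 1ₘ i k) (1ₘ k)) i j)
             -- The entry is the sum over `k` of `1ₘ i k * 1ₘ k j`, that is, row `i` of the identity
             -- times the identity matrix.
             (1ₘ-identityʳ (1ₘ i) j))
    where
    basis : Fin n → V × V
    basis k = (λ i → 1ₘ i k) , 1ₘ k

  -- Any index `i` yields a unit `eᵢ ⊗ eᵢ`; the argument of type `Fin n` is the form in which `n`
  -- being positive enters.
  row⊗column≅K : Fin n → BimoduleIso (tensorProduct Row.bimodule Column.bimodule)
                                     (bisemimodule {R = semiring})
  row⊗column≅K i = unit⇒iso innerPairing [ (1ₘ i , (λ k → 1ₘ k i)) ]
    (trans (eval-[] innerPairing (1ₘ i) (λ k → 1ₘ k i))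
      -- Row `i` of the identity times its column `i` is the diagonal entry `1ₘ i i`.
      (trans (1ₘ-identityʳ (1ₘ i) i) (1ₘ-diagonal i)))
    where
    1ₘ-diagonal : ∀ {m} (i : Fin m) → 1ₘ i i ≈ 1#
    1ₘ-diagonal zero    = refl
    1ₘ-diagonal (suc i) = 1ₘ-diagonal i

proposition19 : ∀ {c ℓ} (K : KleeneAlgebra c ℓ) (n : ℕ) .{{_ : NonZero n}} →
    MoritaEquivalent K (matrixKleeneAlgebra K n)
proposition19 K n@(suc _) = record
  { X     = rowBimodule
  ; Y     = columnBimodule
  -- The index `zero` exists because `n` has been matched as a successor.
  ; X⊗Y≅K = row⊗column≅K zero
  ; Y⊗X≅L = column⊗row≅M
  }
  where open VectorModules K n
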